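{- Let $H=(V,E)$ be a connected hypergraph with $|V|\ge2$ and let $\Omega(H)$ be its multi-tree family. Then for any set of weights $\sigma\in\mathbb{R}^E_{>0}$, $$\operatorname{Mod}_{1,\sigma}(\Omega(H))=S_\sigma(H).$$
   Context: A hypergraph $H=(V,E)$ has a finite nonempty vertex set $V$ and a finite collection $E$ of subsets of $V$ (hyperedges), where repetitions are allowed (parallel hyperedges are distinct elements of $E$) and every hyperedge has at least two vertices. $H$ is connected if for every nonempty proper subset $X\subset V$ some hyperedge intersects both $X$ and $V\setminus X$. For a partition $\mathscr P$ of $V$ into nonempty parts, $|\mathscr P|$ is the number of parts and $\delta(\mathscr P)$ is the set of hyperedges intersecting at least two parts. For $F\subseteq E$, $\sigma(F)=\sum_{e\in F}\sigma(e)$. Weighted strength: $S_\sigma(H)=\min\left\{\frac{\sigma(\delta(\mathscr P))}{|\mathscr P|-1}:\mathscr P\text{ a partition of }V,\ |\mathscr P|\ge2\right\}$. A set (or multiset) $F$ of hyperedges is a hyperforest if for every nonempty $X\subseteq V$ at most $|X|-1$ members of $F$ (counted with multiplicity) are contained in $X$; a hypertree is a hyperforest with $|F|=|V|-1$. For a multiset $A$ from $E$, $H[A]$ is the hypergraph with vertex set $\bigcup_{e\in A}e$ and hyperedges the members of $A$ (copies being parallel hyperedges), and $x^A\in\mathbb{R}^E_{\ge0}$ has $x^A(e)$ equal to the multiplicity of $e$ in $A$. The multi-tree family $\Omega(H)$ is the set of all $x^A$ such that $H[A]$ is a hypertree with vertex set $V$. For a family $\Gamma\subset\mathbb{R}^E_{\ge0}$,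 $\operatorname{Adm}(\Gamma)=\{\rho\in\mathbb{R}^E_{\ge0}:\gamma^T\rho\ge1\ \forall\gamma\in\Gamma\}$ and $\operatorname{Mod}_{1,\sigma}(\Gamma)=\inf_{\rho\in\operatorname{Adm}(\Gamma)}\sum_{e\in E}\sigma(e)\rho(e)$. -}

module Defs where

open import Algebra.Apartness.Bundles using (HeytingField; HeytingCommutativeRing)
open import Algebra.Bundles using (CommutativeRing)
open import Algebra.Core using (Op₂)
import Algebra.Definitions.RawMonoid as RawMonoidDefs
import Algebra.Properties.Ring as RingProperties
open import Data.Bool.Base using (if_then_else_)
open import Data.Fin.Base using (Fin)
open import Data.Fin.Properties using (all?) renaming (_≟_ to _≟ᶠ_)
open import Data.Fin.Subset
  using (Subset; inside; outside; ⊤; ∁; _∩_; ⋃; ∣_∣; Nonempty; Empty; _∈_; _⊆_)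
open import Data.Fin.Subset.Properties using (nonempty?; _∈?_; _⊆?_)
open import Data.List.Base using (List; []; _∷_; _++_; map; filter; length)
open import Data.List.Relation.Unary.All as All using (All)
open import Data.List.Relation.Unary.AllPairs as AllPairs using (AllPairs)
open import Data.List.Relation.Unary.Any as Any using (Any)
open import Data.Nat.Base as ℕ using (ℕ; zero; suc; _∸_; NonZero)
import Data.Nat.Properties as ℕ
open import Data.Product.Base using (∃; ∃-syntax; _×_; _,_)
open import Data.Sum.Base using (_⊎_; inj₂)
open import Data.Vec.Base as Vec using ()
open import Data.Vec.Functional using (Vector)
open import Level using (Level; _⊔_) renaming (suc to lsuc)
open import Relation.Binary.Core using (Rel)
open import Relation.Binary.Definitions using (Cotransitive)
open import Relation.Binary.Lattice.Definitions using (Infimum)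
open import Relation.Binary.PropositionalEquality using (_≡_)
open import Relation.Binary.Structures using (IsStrictPartialOrder)
open import Relation.Nullary using (¬_; Dec; ⌊_⌋; ¬?; _×-dec_)
open import Relation.Unary using (Pred)

private
  variable
    a ℓ : Level
    A : Set a
    n : ℕ

-- The real numbers, axiomatised as a Cauchy-complete Archimedean ordered
-- field.  The order axioms are the constructive ones (cotransitivity in place
-- of trichotomy, binary minima as part of the structure), so that Cauchy and
-- Dedekind reals are models constructively; classically every model is
-- isomorphic to ℝ.
record RealNumbers c ℓ₁ ℓ₂ : Set (lsuc (c ⊔ ℓ₁ ⊔ ℓ₂)) where
  infix  4 _<_ _≤_
  infixl 7 _⊓_

  field
    heytingField : HeytingField c ℓ₁ ℓ₂

  open HeytingField heytingField public
  open HeytingCommutativeRing heytingCommutativeRing public using (commutativeRing)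
  open RawMonoidDefs (CommutativeRing.+-rawMonoid commutativeRing) public
    using (sum) renaming (_×_ to _·_)

  fromℕ : ℕ → Carrier
  fromℕ k = k · 1#

  field
    _<_                  : Rel Carrier ℓ₂
    isStrictPartialOrder : IsStrictPartialOrder _≈_ _<_
    <-cotrans            : Cotransitive _<_
    #⇒<⊎>                : ∀ {x y} → x # y → x < y ⊎ y < x
    <⊎>⇒#                : ∀ {x y} → x < y ⊎ y < x → x # y
    0<1                  : 0# < 1#
    +-monoˡ-<            : ∀ z {x y} → x < y → x + z < y + z
    *-pos                : ∀ {x y} → 0# < x → 0# < y → 0# < x * y

  _≤_ : Rel Carrier ℓ₂
  x ≤ y = ¬ (y < x)

  field
    _⊓_       : Op₂ Carrier
    ⊓-infimum : Infimum _≤_ _⊓_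

  -- ∣ x - y ∣ < ε
  Close : Carrier → Carrier → Carrier → Set ℓ₂
  Close ε x y = x < y + ε × y < x + ε

  field
    archimedean : ∀ x → ∃[ k ] x < fromℕ k
    complete    : ∀ (s : ℕ → Carrier) →
                  (∀ ε → 0# < ε → ∃[ N ] ∀ i j → N ℕ.≤ i → N ℕ.≤ j → Close ε (s i) (s j)) →
                  ∃[ x ] ∀ ε → 0# < ε → ∃[ N ] ∀ i → N ℕ.≤ i → Close ε (s i) x

record Hypergraph : Set where
  field
    ∣V∣ ∣E∣    : ℕ
    V-nonempty : NonZero ∣V∣
    edge       : Fin ∣E∣ → Subset ∣V∣
    edge-size  : ∀ e → 2 ℕ.≤ ∣ edge e ∣

open Hypergraph using (∣V∣; ∣E∣; edge)

Connected : Hypergraph → Set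
Connected H = ∀ (X : Subset (∣V∣ H)) → Nonempty X → Nonempty (∁ X) →
              ∃[ e ] Nonempty (edge H e ∩ X) × Nonempty (edge H e ∩ ∁ X)

IsPartition : List (Subset n) → Set
IsPartition {n} P =
  All Nonempty P × AllPairs (λ p q → Empty (p ∩ q)) P × (∀ (v : Fin n) → Any (v ∈_) P)

isPartition? : (P : List (Subset n)) → Dec (IsPartition P)
isPartition? P =
  All.all? nonempty? P
  ×-dec AllPairs.allPairs? (λ p q → ¬? (nonempty? (p ∩ q))) P
  ×-dec all? (λ v → Any.any? (v ∈?_) P)

subsets : ∀ n → List (Subset n)
subsets zero    = Vec.[] ∷ []
subsets (suc n) = map (inside Vec.∷_) (subsets n) ++ map (outside Vec.∷_) (subsets n)

sublists : List A → List (List A)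
sublists []       = [] ∷ []
sublists (x ∷ xs) = map (x ∷_) (sublists xs) ++ sublists xs

-- All partitions of Fin n with at least two parts.  A set of subsets of Fin n
-- is a sublist of the repetition-free list `subsets n`, so each partition
-- occurs exactly once.
partitions≥2 : ∀ n → List (List (Subset n))
partitions≥2 n =
  filter (λ P → isPartition? P ×-dec (2 ℕ.≤? length P)) (sublists (subsets n))

partsMet : Subset n → List (Subset n) → ℕ
partsMet e P = length (filter (λ p → nonempty? (e ∩ p)) P)

δ : (H : Hypergraph) → List (Subset (∣V∣ H)) → Subset (∣E∣ H)
δ H P = Vec.tabulate λ e → ⌊ 2 ℕ.≤? partsMet (edge H e) P ⌋

-- A multiset is represented by a list of its members, in any order.

IsHyperforest : Subset n → List (Subset n) → Set
IsHyperforest V F =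
  ∀ X → X ⊆ V → Nonempty X → length (filter (_⊆? X) F) ℕ.≤ ∣ X ∣ ∸ 1

IsHypertree : Subset n → List (Subset n) → Set
IsHypertree V F = IsHyperforest V F × length F ≡ ∣ V ∣ ∸ 1

module _ (H : Hypergraph) where

  members : List (Fin (∣E∣ H)) → List (Subset (∣V∣ H))
  members = map (edge H)

  -- H[ A ] has vertex set ⋃ (members A) and hyperedges members A.
  SpansHypertree : List (Fin (∣E∣ H)) → Set
  SpansHypertree A = IsHypertree (⋃ (members A)) (members A) × ⋃ (members A) ≡ ⊤

multiplicity : ∀ {m} → List (Fin m) → Fin m → ℕ
multiplicity A e = length (filter (e ≟ᶠ_) A)

module Modulus {c ℓ₁ ℓ₂} (R : RealNumbers c ℓ₁ ℓ₂) where

  open RealNumbers R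

  private
    variable
      m : ℕ

  fromℕ-pos : ∀ k → 0# < fromℕ (suc k)
  fromℕ-pos zero    =
    IsStrictPartialOrder.<-respʳ-≈ isStrictPartialOrder (sym (+-identityʳ 1#)) 0<1
  fromℕ-pos (suc k) =
    IsStrictPartialOrder.trans isStrictPartialOrder (fromℕ-pos k)
      (IsStrictPartialOrder.<-respˡ-≈ isStrictPartialOrder (+-identityˡ _)
        (+-monoˡ-< (fromℕ (suc k)) 0<1))

  inverse : ∀ {x} → 0# < x → ∃[ y ] x * y ≈ 1#
  inverse {x} 0<x =
    let y , _ , [x-0]y≈1 = #⇒invertible (<⊎>⇒# (inj₂ 0<x))
    in  y , trans (*-congʳ (sym (trans (+-congˡ -0#≈0#) (+-identityʳ x)))) [x-0]y≈1
    where open RingProperties (CommutativeRing.ring commutativeRing)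

  -- The value at zero is a placeholder.
  infixl 7 _/ℕ_
  _/ℕ_ : Carrier → ℕ → Carrier
  x /ℕ zero  = 0#
  x /ℕ suc k = let y , _ = inverse (fromℕ-pos k) in x * y

  -- The value at the empty list is a placeholder.
  minimum : List Carrier → Carrier
  minimum []           = 0#
  minimum (x ∷ [])     = x
  minimum (x ∷ y ∷ ys) = x ⊓ minimum (y ∷ ys)

  IsInfimum : Pred Carrier ℓ → Carrier → Set _
  IsInfimum P s = (∀ x → P x → s ≤ x) × (∀ t → (∀ x → P x → t ≤ x) → t ≤ s)

  weight : Vector Carrier m → Subset m → Carrier
  weight σ F = sum λ e → if Vec.lookup F e then σ e else 0#

  -- For ∣V∣ ≥ 2 the partition into singletons occurs in the list, so the
  -- placeholder values of minimum and _/ℕ_ are not used.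
  strength : (H : Hypergraph) → Vector Carrier (∣E∣ H) → Carrier
  strength H σ =
    minimum (map (λ P → weight σ (δ H P) /ℕ (length P ∸ 1)) (partitions≥2 (∣V∣ H)))

  infix 7 _∙_
  _∙_ : Vector Carrier m → Vector Carrier m → Carrier
  u ∙ v = sum λ e → u e * v e

  Adm : Pred (Vector Carrier m) ℓ → Pred (Vector Carrier m) _
  Adm Γ ρ = (∀ e → 0# ≤ ρ e) × (∀ γ → Γ γ → 1# ≤ γ ∙ ρ)

  -- A relation, since the infimum of an arbitrary family is not a total
  -- operation: Mod₁[ σ , Γ ]≈ s says that the 1-modulus is s.
  Mod₁[_,_]≈_ : Vector Carrier m → Pred (Vector Carrier m) ℓ → Carrier → Set _
  Mod₁[ σ , Γ ]≈ s = IsInfimum (λ x → ∃[ ρ ] Adm Γ ρ × x ≈ σ ∙ ρ) s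

  Ω : (H : Hypergraph) → Pred (Vector Carrier (∣E∣ H)) ℓ₁
  Ω H γ = ∃[ A ] SpansHypertree H A × (∀ e → γ e ≈ fromℕ (multiplicity A e))

{-# OPTIONS --safe #-}

-- For S ≤ Mod, run the greedy algorithm with the edges sorted by ρ: starting
-- from the partition into singletons, an edge meeting k parts merges them and
-- contributes k - 1 copies of itself.  The copies form a spanning hypertree,
-- because at every stage a set X loses at least as many parts as it gains
-- members.  The edges crossing a partition P of the algorithm are still to be
-- processed, and their σ-weight is at least S (|P| - 1); summation by parts
-- bounds σ ∙ ρ below by S times the ρ-weight of the hypertree, which is at
-- least 1.  As x ≤ y is defined as ¬ y < x, the sorting may be done under a
-- double negation.
-- For Mod ≤ S, the indicator of δ(P) divided by |P| - 1 is admissible, since a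
-- spanning hypertree has at least |P| - 1 members crossing P.

module Submission where

open import Defs
open import Data.Nat.Base as ℕ using (ℕ)
open import Data.Vec.Functional using (Vector)
open import Algebra.Bundles using (CommutativeRing)
import Algebra.Properties.CommutativeMonoid.Sum as FiniteSum
import Algebra.Properties.Monoid.Mult as Mult
import Algebra.Properties.Ring as RingProperties
import Algebra.Solver.Ring.NaturalCoefficients.Default as Solver
open import Data.Bool.Base using (true; false; if_then_else_)
import Data.Bool.Properties as Bool
open import Data.Fin.Base using (Fin; fromℕ<)
open import Data.Fin.Properties using () renaming (_≟_ to _≟ᶠ_)
open import Data.Fin.Subset
open import Data.Fin.Subset.Properties
open import Data.List.Base
  using (List; []; _∷_; _++_; map; filter; length; replicate; allFin; tabulate)
open import Data.List.Membership.Propositional using (find; lose) renaming (_∈_ to _∈ₗ_)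
open import Data.List.Membership.Propositional.Properties
open import Data.List.Membership.Propositional.Properties.WithK using (unique∧set⇒bag)
open import Data.List.Properties
  using (filter-all; filter-some; filter-none; filter-++; length-++; length-replicate;
         length-map; length-tabulate)
open import Data.List.Relation.Binary.BagAndSetEquality using (∼bag⇒↭)
open import Data.List.Relation.Binary.Permutation.Propositional
  using (_↭_; module _↭_; ↭-refl; ↭-sym; ↭-trans; ↭-prep; ↭-swap; ↭⇒↭ₛ)
open import Data.List.Relation.Binary.Permutation.Propositional.Properties
  using (All-resp-↭; Any-resp-↭; ∈-resp-↭; filter-↭; ↭-length)
import Data.List.Relation.Binary.Permutation.Setoid.Properties as ↭ₛ
open import Data.List.Relation.Unary.All as All using (All; []; _∷_)
import Data.List.Relation.Unary.All.Properties as All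
open import Data.List.Relation.Unary.AllPairs as AllPairs using (AllPairs; []; _∷_)
import Data.List.Relation.Unary.AllPairs.Properties as AllPairs
open import Data.List.Relation.Unary.Any as Any using (Any; here; there; any?)
import Data.List.Relation.Unary.Any.Properties as Any
open import Data.List.Relation.Unary.Unique.Propositional using (Unique)
import Data.List.Relation.Unary.Unique.Propositional.Properties as Unique
open import Data.Nat.Base using (zero; suc; _∸_; z≤n; s≤s)
import Data.Nat.ListAction as ℕ
import Data.Nat.Properties as ℕ
open import Data.Product.Base using (∃-syntax; _×_; _,_; proj₁; proj₂)
open import Data.Sum.Base as Sum using (_⊎_; inj₁; inj₂)
import Data.Vec.Base as Vec
import Data.Vec.Properties as Vec
open import Function.Base using (_∘_; id; case_of_)
open import Function.Bundles using (mk⇔)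
open import Level using (Level)
open import Relation.Binary.Bundles using (Preorder)
open import Relation.Binary.Core using (Rel)
open import Relation.Binary.Definitions using (Transitive)
open import Relation.Binary.PropositionalEquality as ≡ using (_≡_; _≢_; cong; cong₂; subst)
import Relation.Binary.Reasoning.Preorder as PreorderReasoning
open import Relation.Binary.Structures using (IsStrictPartialOrder)
open import Relation.Nullary using (¬_; yes; no; ¬?; contradiction; _×-dec_; does; ⌊_⌋)
open import Relation.Unary using (Pred; Decidable)

private
  variable
    a p q : Level
    A B : Set a
    n : ℕ

-- Counting list members

count : {P : Pred A p} → Decidable P → List A → ℕ
count P? xs = length (filter P? xs)

count-∷-≤ : {P : Pred A p} (P? : Decidable P) (x : A) →
            ∀ xs → count P? (x ∷ xs) ℕ.≤ suc (count P? xs)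
count-∷-≤ P? x xs with P? x
... | yes _ = ℕ.≤-refl
... | no  _ = ℕ.n≤1+n _

count-++ : {P : Pred A p} (P? : Decidable P) →
           ∀ xs ys → count P? (xs ++ ys) ≡ count P? xs ℕ.+ count P? ys
count-++ P? xs ys = ≡.trans (cong length (filter-++ P? xs ys)) (length-++ (filter P? xs))

count-map : {P : Pred B p} (P? : Decidable P) (f : A → B) →
            ∀ xs → count P? (map f xs) ≡ count (P? ∘ f) xs
count-map P? f []       = ≡.refl
count-map P? f (x ∷ xs) with P? (f x)
... | yes _ = cong suc (count-map P? f xs)
... | no  _ = count-map P? f xs

count-mono : {P : Pred A p} {Q : Pred A q} (P? : Decidable P) (Q? : Decidable Q) →
             (∀ {x} → P x → Q x) → ∀ xs → count P? xs ℕ.≤ count Q? xs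
count-mono P? Q? P⊆Q []       = z≤n
count-mono P? Q? P⊆Q (x ∷ xs) with P? x | Q? x
... | yes Px | yes Qx = s≤s (count-mono P? Q? P⊆Q xs)
... | yes Px | no ¬Qx = contradiction (P⊆Q Px) ¬Qx
... | no ¬Px | yes Qx = ℕ.m≤n⇒m≤1+n (count-mono P? Q? P⊆Q xs)
... | no ¬Px | no ¬Qx = count-mono P? Q? P⊆Q xs

count-⊎ : ∀ {p q r} {P : Pred A p} {Q : Pred A q} {R : Pred A r}
          (P? : Decidable P) (Q? : Decidable Q) (R? : Decidable R) →
          (∀ {x} → P x → Q x ⊎ R x) → ∀ xs → count P? xs ℕ.≤ count Q? xs ℕ.+ count R? xs
count-⊎ P? Q? R? P⊆Q∪R []       = z≤n
count-⊎ P? Q? R? P⊆Q∪R (x ∷ xs) with P? x | Q? x | R? x | count-⊎ P? Q? R? P⊆Q∪R xs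
... | yes _  | yes _  | yes _  | ih = s≤s (ℕ.≤-trans ih (ℕ.+-monoʳ-≤ _ (ℕ.n≤1+n _)))
... | yes _  | yes _  | no  _  | ih = s≤s ih
... | yes _  | no  _  | yes _  | ih = ℕ.≤-trans (s≤s ih) (ℕ.≤-reflexive (≡.sym (ℕ.+-suc _ _)))
... | yes Px | no ¬Qx | no ¬Rx | _  = contradiction (P⊆Q∪R Px) Sum.[ ¬Qx , ¬Rx ]
... | no  _  | yes _  | yes _  | ih = ℕ.m≤n⇒m≤1+n (ℕ.≤-trans ih (ℕ.+-monoʳ-≤ _ (ℕ.n≤1+n _)))
... | no  _  | yes _  | no  _  | ih = ℕ.m≤n⇒m≤1+n ih
... | no  _  | no  _  | yes _  | ih = ℕ.≤-trans ih (ℕ.+-monoʳ-≤ _ (ℕ.n≤1+n _))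
... | no  _  | no  _  | no  _  | ih = ih

count-split : {P : Pred A p} {Q : Pred A q} (P? : Decidable P) (Q? : Decidable Q) → ∀ xs →
              count P? (filter Q? xs) ℕ.+ count P? (filter (¬? ∘ Q?) xs) ≡ count P? xs
count-split P? Q? []       = ≡.refl
count-split P? Q? (x ∷ xs) with Q? x | count-split P? Q? xs
... | yes _ | ih with P? x
...   | yes _ = cong suc ih
...   | no  _ = ih
count-split P? Q? (x ∷ xs) | no _ | ih with P? x
...   | yes _ = ≡.trans (ℕ.+-suc _ _) (cong suc ih)
...   | no  _ = ih

length-split : {Q : Pred A q} (Q? : Decidable Q) → ∀ xs →
               count Q? xs ℕ.+ count (¬? ∘ Q?) xs ≡ length xs
length-split Q? []       = ≡.refl
length-split Q? (x ∷ xs) with Q? x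
... | yes _ = cong suc (length-split Q? xs)
... | no  _ = ≡.trans (ℕ.+-suc _ _) (cong suc (length-split Q? xs))

-- A union bound: on the right a member is counted once for every index that it satisfies.
count-any : {I : Set a} {P : I → Pred A p} (P? : ∀ i → Decidable (P i)) (is : List I) → ∀ xs →
            count (λ x → any? (λ i → P? i x) is) xs ℕ.≤ ℕ.sum (map (λ i → count (P? i) xs) is)
count-any P? []       xs =
  ℕ.≤-reflexive (cong length (filter-none (λ x → any? (λ i → P? i x) []) (All.universal (λ _ ()) xs)))
count-any P? (i ∷ is) xs = ℕ.≤-trans
  (count-⊎ (λ x → any? (λ i → P? i x) (i ∷ is)) (P? i) (λ x → any? (λ i → P? i x) is) Any.toSum xs)
  (ℕ.+-monoʳ-≤ _ (count-any P? is xs))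

two-members : {xs : List A} {x y : A} → x ∈ₗ xs → y ∈ₗ xs → x ≢ y → 2 ℕ.≤ length xs
two-members {xs = _ ∷ _ ∷ _} _           _           _   = s≤s (s≤s z≤n)
two-members {xs = _ ∷ []}    (here x≡z)  (here y≡z)  x≢y = contradiction (≡.trans x≡z (≡.sym y≡z)) x≢y

-- Merging the parts of a partition which meet a given set

Disjoint : List (Subset n) → Set
Disjoint = AllPairs λ p q → Empty (p ∩ q)

module _ {P : List (Subset n)} (isP : IsPartition P) where

  nonempty-parts : All Nonempty P
  nonempty-parts = proj₁ isP

  disjoint-parts : Disjoint P
  disjoint-parts = proj₁ (proj₂ isP)

  covered : ∀ v → Any (v ∈_) P
  covered = proj₂ (proj₂ isP)

shared⇒≡ : {P : List (Subset n)} → Disjoint P → ∀ {p q v} →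
           p ∈ₗ P → q ∈ₗ P → v ∈ p → v ∈ q → p ≡ q
shared⇒≡ (_ ∷ _)  (here ≡.refl) (here ≡.refl) _   _   = ≡.refl
shared⇒≡ (d ∷ _)  (here ≡.refl) (there q∈P)   v∈p v∈q =
  contradiction (_ , x∈p∩q⁺ (v∈p , v∈q)) (All.lookup d q∈P)
shared⇒≡ (d ∷ _)  (there p∈P)   (here ≡.refl) v∈p v∈q =
  contradiction (_ , x∈p∩q⁺ (v∈q , v∈p)) (All.lookup d p∈P)
shared⇒≡ (_ ∷ ds) (there p∈P)   (there q∈P)   v∈p v∈q = shared⇒≡ ds p∈P q∈P v∈p v∈q

meets? : (X : Subset n) → Decidable (λ p → Nonempty (X ∩ p))
meets? X p = nonempty? (X ∩ p)

hits misses : Subset n → List (Subset n) → List (Subset n)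
hits   e P = filter (meets? e) P
misses e P = filter (¬? ∘ meets? e) P

-- If `e` meets no part, the new head is the empty set; `merge-isPartition` therefore asks for a
-- nonempty `e`.
merge : Subset n → List (Subset n) → List (Subset n)
merge e P = ⋃ (hits e P) ∷ misses e P

∈-⋃⁺ : ∀ {v} {P : List (Subset n)} → Any (v ∈_) P → v ∈ ⋃ P
∈-⋃⁺ {P = p ∷ P} (here v∈p)  = x∈p∪q⁺ (inj₁ v∈p)
∈-⋃⁺ {P = p ∷ P} (there v∈P) = x∈p∪q⁺ (inj₂ (∈-⋃⁺ v∈P))

∈-⋃⁻ : ∀ {v} (P : List (Subset n)) → v ∈ ⋃ P → Any (v ∈_) P
∈-⋃⁻ []      v∈⊥ = contradiction v∈⊥ ∉⊥
∈-⋃⁻ (p ∷ P) v∈  with x∈p∪q⁻ p (⋃ P) v∈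
... | inj₁ v∈p = here v∈p
... | inj₂ v∈P = there (∈-⋃⁻ P v∈P)

1≤partsMet : ∀ {X p : Subset n} {P} → p ∈ₗ P → Nonempty (X ∩ p) → 1 ℕ.≤ partsMet X P
1≤partsMet {X = X} p∈P X∩p = filter-some (meets? X) (lose p∈P X∩p)

2≤partsMet : ∀ {X p q : Subset n} {P} → p ∈ₗ P → q ∈ₗ P → p ≢ q →
             Nonempty (X ∩ p) → Nonempty (X ∩ q) → 2 ℕ.≤ partsMet X P
2≤partsMet {X = X} p∈P q∈P p≢q X∩p X∩q =
  two-members (∈-filter⁺ (meets? X) p∈P X∩p) (∈-filter⁺ (meets? X) q∈P X∩q) p≢q

partsMet-nonempty : ∀ {X : Subset n} {P} → IsPartition P → Nonempty X → 1 ℕ.≤ partsMet X P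
partsMet-nonempty isP (v , v∈X) with find (covered isP v)
... | p , p∈P , v∈p = 1≤partsMet p∈P (v , x∈p∩q⁺ (v∈X , v∈p))

⊆⇒∩-nonempty : ∀ {e X p : Subset n} → e ⊆ X → Nonempty (e ∩ p) → Nonempty (X ∩ p)
⊆⇒∩-nonempty {e = e} {p = p} e⊆X (v , v∈) =
  let v∈e , v∈p = x∈p∩q⁻ e p v∈ in v , x∈p∩q⁺ (e⊆X v∈e , v∈p)

length-merge : ∀ (e : Subset n) P → length (merge e P) ℕ.+ partsMet e P ≡ suc (length P)
length-merge e P = cong suc (≡.trans (ℕ.+-comm (length (misses e P)) _) (length-split (meets? e) P))

-- If `X` meets the merged part, it already meets one of the parts merged into it, so the part
-- gained replaces at least one part lost.
partsMet-merge-≤ : ∀ (X e : Subset n) P → partsMet X (merge e P) ℕ.≤ partsMet X P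
partsMet-merge-≤ X e P with meets? X (⋃ (hits e P))
... | no  _        = ℕ.≤-trans (ℕ.m≤n+m _ _) (ℕ.≤-reflexive (count-split (meets? X) (meets? e) P))
... | yes (v , v∈) with v∈X , v∈⋃ ← x∈p∩q⁻ X (⋃ (hits e P)) v∈
                   with p , p∈ , v∈p ← find (∈-⋃⁻ (hits e P) v∈⋃) =
  ℕ.≤-trans (ℕ.+-monoˡ-≤ _ (1≤partsMet p∈ (v , x∈p∩q⁺ (v∈X , v∈p))))
            (ℕ.≤-reflexive (count-split (meets? X) (meets? e) P))

-- A superset of `e` meets every part that `e` meets. All of these disappear and at most the merged
-- part is gained, which pays for the copies of `e` in the sparsity count.
partsMet-merge-⊆ : ∀ {e X : Subset n} P → e ⊆ X →
                   partsMet X (merge e P) ℕ.+ partsMet e P ℕ.≤ suc (partsMet X P)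
partsMet-merge-⊆ {e = e} {X} P e⊆X = begin
  partsMet X (merge e P) ℕ.+ partsMet e P
    ≤⟨ ℕ.+-monoˡ-≤ _ (count-∷-≤ (meets? X) (⋃ (hits e P)) (misses e P)) ⟩
  suc (partsMet X (misses e P) ℕ.+ partsMet e P)
    ≡⟨ cong suc (ℕ.+-comm (partsMet X (misses e P)) _) ⟩
  suc (partsMet e P ℕ.+ partsMet X (misses e P))
    ≡⟨ cong (λ Q → suc (length Q ℕ.+ partsMet X (misses e P))) hits-met ⟨
  suc (partsMet X (hits e P) ℕ.+ partsMet X (misses e P))
    ≡⟨ cong suc (count-split (meets? X) (meets? e) P) ⟩
  suc (partsMet X P) ∎
  where
  open ℕ.≤-Reasoning
  hits-met : filter (meets? X) (hits e P) ≡ hits e P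
  hits-met = filter-all (meets? X) (All.map (⊆⇒∩-nonempty e⊆X) (All.all-filter (meets? e) P))

-- The case `X = e` of the preceding bound, so a processed edge no longer crosses.
partsMet-merge-self : ∀ (e : Subset n) P → partsMet e (merge e P) ℕ.≤ 1
partsMet-merge-self e P = ℕ.+-cancelʳ-≤ (partsMet e P) _ 1 (partsMet-merge-⊆ P id)

merge-isPartition : ∀ {e : Subset n} {P} → Nonempty e → IsPartition P → IsPartition (merge e P)
merge-isPartition {e = e} {P} (u , u∈e) isP =
    (⋃-nonempty ∷ All.filter⁺ (¬? ∘ meets? e) (nonempty-parts isP))
  , (All.tabulate ⋃-disjoint ∷ AllPairs.filter⁺ (¬? ∘ meets? e) (disjoint-parts isP))
  , covers
  where
  ⋃-nonempty : Nonempty (⋃ (hits e P))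
  ⋃-nonempty with p , p∈P , u∈p ← find (covered isP u) =
    u , ∈-⋃⁺ (lose (∈-filter⁺ (meets? e) p∈P (u , x∈p∩q⁺ (u∈e , u∈p))) u∈p)

  -- A common vertex would lie in a part met by `e` and in a part missed by `e`, and disjointness
  -- forces these to be equal.
  ⋃-disjoint : ∀ {q} → q ∈ₗ misses e P → Empty (⋃ (hits e P) ∩ q)
  ⋃-disjoint {q} q∈ (v , v∈)
    with v∈⋃ , v∈q ← x∈p∩q⁻ (⋃ (hits e P)) q v∈
    with p , p∈ , v∈p ← find (∈-⋃⁻ (hits e P) v∈⋃)
    with p∈P , e∩p ← ∈-filter⁻ (meets? e) {xs = P} p∈
    with q∈P , e∩̸q ← ∈-filter⁻ (¬? ∘ meets? e) {xs = P} q∈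
    with ≡.refl ← shared⇒≡ (disjoint-parts isP) p∈P q∈P v∈p v∈q = e∩̸q e∩p

  covers : ∀ v → Any (v ∈_) (merge e P)
  covers v with p , p∈P , v∈p ← find (covered isP v) with meets? e p
  ... | yes e∩p = here (∈-⋃⁺ (lose (∈-filter⁺ (meets? e) p∈P e∩p) v∈p))
  ... | no e∩̸p  = there (lose (∈-filter⁺ (¬? ∘ meets? e) p∈P e∩̸p) v∈p)

-- Cardinalities of the parts

∣X∣≡∣X∩p∣+∣X∩∁p∣ : ∀ (X p : Subset n) → ∣ X ∣ ≡ ∣ X ∩ p ∣ ℕ.+ ∣ X ∩ ∁ p ∣
∣X∣≡∣X∩p∣+∣X∩∁p∣ Vec.[]              Vec.[]              = ≡.refl
∣X∣≡∣X∩p∣+∣X∩∁p∣ (outside Vec.∷ X) (_       Vec.∷ p) = ∣X∣≡∣X∩p∣+∣X∩∁p∣ X p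
∣X∣≡∣X∩p∣+∣X∩∁p∣ (inside  Vec.∷ X) (inside  Vec.∷ p) = cong suc (∣X∣≡∣X∩p∣+∣X∩∁p∣ X p)
∣X∣≡∣X∩p∣+∣X∩∁p∣ (inside  Vec.∷ X) (outside Vec.∷ p) =
  ≡.trans (cong suc (∣X∣≡∣X∩p∣+∣X∩∁p∣ X p)) (≡.sym (ℕ.+-suc _ _))

sum-mono : {P : List A} {f g : A → ℕ} → All (λ x → f x ℕ.≤ g x) P → ℕ.sum (map f P) ℕ.≤ ℕ.sum (map g P)
sum-mono []         = z≤n
sum-mono (le ∷ les) = ℕ.+-mono-≤ le (sum-mono les)

-- Induction on the parts with `X` varying: the later parts avoid `p`, so `X` may be cut down to
-- `X ∩ ∁ p` for them.
∑∣X∩p∣≤∣X∣ : ∀ (X : Subset n) {P} → Disjoint P → ℕ.sum (map (λ p → ∣ X ∩ p ∣) P) ℕ.≤ ∣ X ∣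
∑∣X∩p∣≤∣X∣ X []                 = z≤n
∑∣X∩p∣≤∣X∣ X {p ∷ P} (d ∷ ds) = begin
  ∣ X ∩ p ∣ ℕ.+ ℕ.sum (map (λ q → ∣ X ∩ q ∣) P)
    ≤⟨ ℕ.+-monoʳ-≤ ∣ X ∩ p ∣ (sum-mono (All.map (λ {q} p∩q → p⊆q⇒∣p∣≤∣q∣ (avoid q p∩q)) d)) ⟩
  ∣ X ∩ p ∣ ℕ.+ ℕ.sum (map (λ q → ∣ (X ∩ ∁ p) ∩ q ∣) P)
    ≤⟨ ℕ.+-monoʳ-≤ ∣ X ∩ p ∣ (∑∣X∩p∣≤∣X∣ (X ∩ ∁ p) ds) ⟩
  ∣ X ∩ p ∣ ℕ.+ ∣ X ∩ ∁ p ∣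
    ≡⟨ ∣X∣≡∣X∩p∣+∣X∩∁p∣ X p ⟨
  ∣ X ∣ ∎
  where
  open ℕ.≤-Reasoning
  avoid : ∀ q → Empty (p ∩ q) → X ∩ q ⊆ (X ∩ ∁ p) ∩ q
  avoid q p∩q v∈ with v∈X , v∈q ← x∈p∩q⁻ X q v∈ =
    x∈p∩q⁺ (x∈p∩q⁺ (v∈X , x∉p⇒x∈∁p λ v∈p → p∩q (_ , x∈p∩q⁺ (v∈p , v∈q))) , v∈q)

Nonempty⇒1≤∣∣ : ∀ {p : Subset n} → Nonempty p → 1 ℕ.≤ ∣ p ∣
Nonempty⇒1≤∣∣ {p = p} (v , v∈p) = subst (ℕ._≤ ∣ p ∣) (∣⁅x⁆∣≡1 v)
  (p⊆q⇒∣p∣≤∣q∣ λ w∈ → subst (_∈ p) (≡.sym (x∈⁅y⁆⇒x≡y v w∈)) v∈p)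

partsMet≤∣∣ : ∀ (X : Subset n) {P} → Disjoint P → partsMet X P ℕ.≤ ∣ X ∣
partsMet≤∣∣ X {P} ds = ℕ.≤-trans (bound P) (∑∣X∩p∣≤∣X∣ X ds)
  where
  bound : ∀ P → partsMet X P ℕ.≤ ℕ.sum (map (λ p → ∣ X ∩ p ∣) P)
  bound []      = z≤n
  bound (p ∷ P) with meets? X p
  ... | yes X∩p = ℕ.+-mono-≤ (Nonempty⇒1≤∣∣ X∩p) (bound P)
  ... | no  _   = ℕ.≤-trans (bound P) (ℕ.m≤n+m _ _)

-- The partition into singletons

singletons : ∀ n → List (Subset n)
singletons n = map ⁅_⁆ (allFin n)

length-singletons : ∀ n → length (singletons n) ≡ n
length-singletons n = ≡.trans (length-map ⁅_⁆ (allFin n)) (length-tabulate {n = n} id)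

singletons-isPartition : ∀ n → IsPartition (singletons n)
singletons-isPartition n =
    All.map⁺ (All.universal (λ v → v , x∈⁅x⁆ v) (allFin n))
  , AllPairs.map⁺ (AllPairs.map disj (Unique.allFin⁺ n))
  , λ v → lose (∈-map⁺ ⁅_⁆ (∈-allFin v)) (x∈⁅x⁆ v)
  where
  disj : ∀ {i j : Fin n} → i ≢ j → Empty (⁅ i ⁆ ∩ ⁅ j ⁆)
  disj {i} {j} i≢j (v , v∈) with v∈i , v∈j ← x∈p∩q⁻ ⁅ i ⁆ ⁅ j ⁆ v∈ =
    i≢j (≡.trans (≡.sym (x∈⁅y⁆⇒x≡y i v∈i)) (x∈⁅y⁆⇒x≡y j v∈j))

1≤∣∣⇒Nonempty : ∀ {p : Subset n} → 1 ℕ.≤ ∣ p ∣ → Nonempty p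
1≤∣∣⇒Nonempty {n} {p} 1≤ with nonempty? p
... | yes ne = ne
... | no  em with ≡.refl ← Empty-unique em = contradiction (subst (1 ℕ.≤_) (∣⊥∣≡0 n) 1≤) λ ()

1+∣∁⁅v⁆∣≡n : ∀ (v : Fin n) → suc ∣ ∁ ⁅ v ⁆ ∣ ≡ n
1+∣∁⁅v⁆∣≡n {n} v = ≡.trans (cong suc (≡.trans (∣∁p∣≡n∸∣p∣ ⁅ v ⁆) (cong (n ∸_) (∣⁅x⁆∣≡1 v)))) (lemma v)
  where
  lemma : ∀ {n} → Fin n → suc (n ∸ 1) ≡ n
  lemma {suc n} _ = ≡.refl

-- The greedy hypertree

module _ (H : Hypergraph) where

  open Hypergraph H

  edge-nonempty : ∀ e → Nonempty (edge e)
  edge-nonempty e = 1≤∣∣⇒Nonempty (ℕ.≤-trans (s≤s z≤n) (edge-size e))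

  Crosses : List (Subset ∣V∣) → Fin ∣E∣ → Set
  Crosses P e = 2 ℕ.≤ partsMet (edge e) P

  -- Kruskal's algorithm with multiplicities: `P` holds the current components, and an edge inside
  -- one of them contributes no copy.
  greedy : List (Subset ∣V∣) → List (Fin ∣E∣) → List (Fin ∣E∣)
  greedy P []       = []
  greedy P (e ∷ es) = replicate (partsMet (edge e) P ∸ 1) e ++ greedy (merge (edge e) P) es

  within : Subset ∣V∣ → List (Fin ∣E∣) → ℕ
  within X = count (λ e → edge e ⊆? X)

  -- Maintains the invariant that the crossing edges are still to be processed: merging creates no
  -- new crossing, and `e` itself stops crossing.
  merge-crosses : ∀ {P e es} → (∀ f → Crosses P f → f ∈ₗ e ∷ es) →
                  ∀ f → Crosses (merge (edge e) P) f → f ∈ₗ es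
  merge-crosses {P} {e} crossing f 2≤
    with crossing f (ℕ.≤-trans 2≤ (partsMet-merge-≤ (edge f) (edge e) P))
  ... | there f∈es    = f∈es
  ... | here ≡.refl = contradiction (ℕ.≤-trans 2≤ (partsMet-merge-self (edge e) P)) λ { (s≤s ()) }

  -- `partsMet X P` is a potential. An edge inside `X` that meets `suc k` parts adds `k` members and
  -- lowers the potential by at least `k`; any other edge adds no member inside `X` and does not
  -- raise it. At the end the potential is still at least 1.
  greedy-sparse : ∀ {P} es → IsPartition P → ∀ X → Nonempty X →
                  suc (within X (greedy P es)) ℕ.≤ partsMet X P
  greedy-sparse     []       isP X X≠∅ = partsMet-nonempty isP X≠∅
  greedy-sparse {P} (e ∷ es) isP X X≠∅
    rewrite count-++ (λ f → edge f ⊆? X) (replicate (partsMet (edge e) P ∸ 1) e) (greedy (merge (edge e) P) es)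
    with edge e ⊆? X | greedy-sparse es (merge-isPartition (edge-nonempty e) isP) X X≠∅
  ... | no e⊈X | ih
    rewrite filter-none (λ f → edge f ⊆? X) (All.replicate⁺ (partsMet (edge e) P ∸ 1) e⊈X) =
    ℕ.≤-trans ih (partsMet-merge-≤ X (edge e) P)
  ... | yes e⊆X | ih
    -- A nonempty edge meets some part, so the truncated subtraction in `greedy` is exact.
    with partsMet (edge e) P | partsMet-nonempty isP (edge-nonempty e) | partsMet-merge-⊆ P e⊆X
  ...   | suc k | _ | bound
    rewrite filter-all (λ f → edge f ⊆? X) (All.replicate⁺ k e⊆X) | length-replicate k {x = e} = begin
    suc (k ℕ.+ within X (greedy (merge (edge e) P) es)) ≡⟨ ℕ.+-suc k _ ⟨
    k ℕ.+ suc (within X (greedy (merge (edge e) P) es)) ≤⟨ ℕ.+-monoʳ-≤ k ih ⟩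
    k ℕ.+ partsMet X (merge (edge e) P)                 ≡⟨ ℕ.+-comm k _ ⟩
    partsMet X (merge (edge e) P) ℕ.+ k
      ≤⟨ ℕ.s≤s⁻¹ (ℕ.≤-trans (ℕ.≤-reflexive (≡.sym (ℕ.+-suc _ k))) bound) ⟩
    partsMet X P                                        ∎
    where open ℕ.≤-Reasoning

  -- With two parts, connectedness at the first part gives an edge that leaves it and hence crosses.
  -- An empty list of parts cannot cover the nonempty vertex set.
  uncrossed⇒length≡1 : Connected H → ∀ {P} → IsPartition P → (∀ e → ¬ Crosses P e) → length P ≡ 1
  uncrossed⇒length≡1 conn {[]}        isP _ =
    contradiction (covered isP (fromℕ< (ℕ.>-nonZero⁻¹ ∣V∣ {{V-nonempty}}))) λ ()
  uncrossed⇒length≡1 conn {_ ∷ []}    isP _       = ≡.refl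
  uncrossed⇒length≡1 conn {p ∷ q ∷ P} isP@(p≠∅ ∷ (v , v∈q) ∷ _ , (pq ∷ _) ∷ _ , _) uncrossed
    with e , e∩p , (w , w∈) ← conn p p≠∅ (v , x∉p⇒x∈∁p λ v∈p → pq (v , x∈p∩q⁺ (v∈p , v∈q)))
    with w∈e , w∈∁p ← x∈p∩q⁻ (edge e) (∁ p) w∈
    with r , r∈P , w∈r ← find (covered isP w) =
    contradiction (2≤partsMet (here ≡.refl) r∈P (λ { ≡.refl → x∈∁p⇒x∉p w∈∁p w∈r })
                              e∩p (w , x∈p∩q⁺ (w∈e , w∈r)))
                  (uncrossed e)

  -- Every step adds as many members as it removes parts, and when no edge is left a single part
  -- remains.
  greedy-length : Connected H → ∀ {P} es → IsPartition P → (∀ f → Crosses P f → f ∈ₗ es) →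
                  suc (length (greedy P es)) ≡ length P
  greedy-length conn []           isP crossing =
    ≡.sym (uncrossed⇒length≡1 conn isP λ e c → contradiction (crossing e c) λ ())
  greedy-length conn {P} (e ∷ es) isP crossing
    rewrite length-++ (replicate (partsMet (edge e) P ∸ 1) e) {greedy (merge (edge e) P) es}
          | length-replicate (partsMet (edge e) P ∸ 1) {x = e}
    with greedy-length conn es (merge-isPartition (edge-nonempty e) isP) (merge-crosses {P} crossing)
       | partsMet (edge e) P | partsMet-nonempty isP (edge-nonempty e) | length-merge (edge e) P
  ... | ih | suc k | _ | eq = begin
    suc (k ℕ.+ length (greedy (merge (edge e) P) es)) ≡⟨ ℕ.+-suc k _ ⟨
    k ℕ.+ suc (length (greedy (merge (edge e) P) es)) ≡⟨ cong (k ℕ.+_) ih ⟩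
    k ℕ.+ length (merge (edge e) P)                   ≡⟨ ℕ.+-comm k _ ⟩
    length (merge (edge e) P) ℕ.+ k                   ≡⟨ ℕ.suc-injective (≡.trans (≡.sym (ℕ.+-suc _ k)) eq) ⟩
    length P                                          ∎
    where open ≡.≡-Reasoning

  -- From the singletons, `X` meets at most `∣ X ∣` parts, so the potential bound becomes the
  -- hyperforest condition. That every vertex is covered then follows from sparsity and the number
  -- of members.
  greedy-spans : Connected H → 2 ℕ.≤ ∣V∣ → ∀ es → (∀ e → e ∈ₗ es) →
                 SpansHypertree H (greedy (singletons ∣V∣) es)
  greedy-spans conn 2≤∣V∣ es all-es =
    subst (λ U → IsHypertree U (members H T)) (≡.sym ⋃≡⊤) (forest , size) , ⋃≡⊤
    where
    T : List (Fin ∣E∣)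
    T = greedy (singletons ∣V∣) es

    isP : IsPartition (singletons ∣V∣)
    isP = singletons-isPartition ∣V∣

    sparse : ∀ X → Nonempty X → within X T ℕ.< ∣ X ∣
    sparse X X≠∅ = ℕ.≤-trans (greedy-sparse es isP X X≠∅) (partsMet≤∣∣ X (disjoint-parts isP))

    length-T : suc (length T) ≡ ∣V∣
    length-T = ≡.trans (greedy-length conn es isP λ e _ → all-es e) (length-singletons ∣V∣)

    forest : IsHyperforest ⊤ (members H T)
    forest X _ X≠∅ = subst (ℕ._≤ ∣ X ∣ ∸ 1) (≡.sym (count-map (_⊆? X) edge T)) (ℕ.∸-monoˡ-≤ 1 (sparse X X≠∅))

    size : length (members H T) ≡ ∣ ⊤ {∣V∣} ∣ ∸ 1
    size = ≡.trans (length-map edge T) (≡.trans (cong (_∸ 1) length-T) (cong (_∸ 1) (≡.sym (∣⊤∣≡n ∣V∣))))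

    ⋃≡⊤ : ⋃ (members H T) ≡ ⊤
    ⋃≡⊤ = ⊆-antisym ⊆⊤ λ {v} _ → covers v
      where
      -- If no member contains v, then all |V| - 1 members lie in the complement
      -- of v, which has |V| - 1 elements.
      covers : ∀ v → v ∈ ⋃ (members H T)
      covers v with v ∈? ⋃ (members H T)
      ... | yes v∈ = v∈
      ... | no  v∉ = contradiction (sparse (∁ ⁅ v ⁆) (1≤∣∣⇒Nonempty 1≤)) (ℕ.≤⇒≯ (ℕ.≤-reflexive (≡.sym all-within)))
        where
        1≤ : 1 ℕ.≤ ∣ ∁ ⁅ v ⁆ ∣
        1≤ = ℕ.s≤s⁻¹ (subst (2 ℕ.≤_) (≡.sym (1+∣∁⁅v⁆∣≡n v)) 2≤∣V∣)
        avoids : ∀ {e} → e ∈ₗ T → edge e ⊆ ∁ ⁅ v ⁆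
        avoids {e} e∈T {w} w∈e = x∉p⇒x∈∁p λ w∈v →
          v∉ (∈-⋃⁺ (lose (∈-map⁺ edge e∈T) (subst (_∈ edge e) (x∈⁅y⁆⇒x≡y v w∈v) w∈e)))
        all-within : within (∁ ⁅ v ⁆) T ≡ ∣ ∁ ⁅ v ⁆ ∣
        all-within = ≡.trans (cong length (filter-all (λ e → edge e ⊆? ∁ ⁅ v ⁆) (All.tabulate avoids)))
                             (ℕ.suc-injective (≡.trans length-T (≡.sym (1+∣∁⁅v⁆∣≡n v))))

  -- A member which does not cross P lies in a part, and a part p contains at
  -- most |p| - 1 members.
  crossing-members : ∀ A P → SpansHypertree H A → IsPartition P →
                     length P ℕ.≤ suc (count (λ e → 2 ℕ.≤? partsMet (edge e) P) A)
  -- The members inside parts are added on both sides, and the two sums are compared through the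
  -- number of vertices.
  crossing-members A P ((forest , size) , ⋃≡⊤) isP = ℕ.+-cancelʳ-≤ inside-parts _ _ (begin
    length P ℕ.+ inside-parts     ≤⟨ parts-sparse (nonempty-parts isP) ⟩
    ℕ.sum (map ∣_∣ P)
      ≤⟨ sum-mono (All.universal (λ p → p⊆q⇒∣p∣≤∣q∣ {p = p} {⊤ ∩ p} λ v∈p → x∈p∩q⁺ (∈⊤ , v∈p)) P) ⟩
    ℕ.sum (map (λ p → ∣ ⊤ ∩ p ∣) P) ≤⟨ ∑∣X∩p∣≤∣X∣ ⊤ (disjoint-parts isP) ⟩
    ∣ ⊤ {∣V∣} ∣                   ≤⟨ length-A ⟩
    suc (length A)                ≡⟨ cong suc (length-split crosses? A) ⟨
    suc (count crosses? A ℕ.+ count (¬? ∘ crosses?) A)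
      ≤⟨ s≤s (ℕ.+-monoʳ-≤ (count crosses? A) (ℕ.≤-trans
           (count-mono (¬? ∘ crosses?) (λ e → any? (edge e ⊆?_) P) in-part A)
           (count-any (λ p e → edge e ⊆? p) P A))) ⟩
    suc (count crosses? A) ℕ.+ inside-parts ∎)
    where
    open ℕ.≤-Reasoning

    crosses? : Decidable (Crosses P)
    crosses? e = 2 ℕ.≤? partsMet (edge e) P

    inside-parts : ℕ
    inside-parts = ℕ.sum (map (λ p → within p A) P)

    length-A : ∣ ⊤ {∣V∣} ∣ ℕ.≤ suc (length A)
    length-A = ℕ.≤-trans (ℕ.m≤n+m∸n ∣ ⊤ {∣V∣} ∣ 1) (ℕ.≤-reflexive (cong suc
      (≡.sym (≡.trans (≡.sym (length-map edge A)) (≡.trans size (cong (λ U → ∣ U ∣ ∸ 1) ⋃≡⊤))))))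

    sparse : ∀ {p} → Nonempty p → within p A ℕ.< ∣ p ∣
    sparse {p} p≠∅ with ∣ p ∣ | Nonempty⇒1≤∣∣ p≠∅ | forest p (subst (p ⊆_) (≡.sym ⋃≡⊤) ⊆⊤) p≠∅
    ... | suc _ | _ | bound = s≤s (subst (ℕ._≤ _) (count-map (_⊆? p) edge A) bound)

    parts-sparse : ∀ {P} → All Nonempty P → length P ℕ.+ ℕ.sum (map (λ p → within p A) P) ℕ.≤ ℕ.sum (map ∣_∣ P)
    parts-sparse {[]}    []           = z≤n
    parts-sparse {p ∷ P} (p≠∅ ∷ P≠∅) = begin
      suc (length P ℕ.+ (within p A ℕ.+ w)) ≡⟨ cong suc (ℕ.+-assoc (length P) _ _) ⟨
      suc (length P ℕ.+ within p A ℕ.+ w)   ≡⟨ cong (λ k → suc (k ℕ.+ w)) (ℕ.+-comm (length P) _) ⟩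
      suc (within p A ℕ.+ length P ℕ.+ w)   ≡⟨ cong suc (ℕ.+-assoc (within p A) _ _) ⟩
      suc (within p A) ℕ.+ (length P ℕ.+ w) ≤⟨ ℕ.+-mono-≤ (sparse p≠∅) (parts-sparse P≠∅) ⟩
      ∣ p ∣ ℕ.+ ℕ.sum (map ∣_∣ P)             ∎
      where
      w : ℕ
      w = ℕ.sum (map (λ q → within q A) P)

    -- Take the part of one vertex of `e`; a vertex of `e` outside it would give a second part met
    -- by `e`.
    in-part : ∀ {e} → ¬ Crosses P e → Any (edge e ⊆_) P
    in-part {e} ¬crosses
      with v , v∈e ← edge-nonempty e
      with p , p∈P , v∈p ← find (covered isP v) = lose p∈P e⊆p
      where
      e⊆p : edge e ⊆ p
      e⊆p {w} w∈e with w ∈? p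
      ... | yes w∈p = w∈p
      ... | no  w∉p with q , q∈P , w∈q ← find (covered isP w) =
        contradiction (2≤partsMet p∈P q∈P (λ { ≡.refl → w∉p w∈q })
                                  (v , x∈p∩q⁺ (v∈e , v∈p)) (w , x∈p∩q⁺ (w∈e , w∈q)))
                      ¬crosses

-- Listed partitions

filter∈sublists : {P : Pred A p} (P? : Decidable P) → ∀ xs → filter P? xs ∈ₗ sublists xs
filter∈sublists P? []       = here ≡.refl
filter∈sublists P? (x ∷ xs) with P? x
... | yes _ = ∈-++⁺ˡ (∈-map⁺ (x ∷_) (filter∈sublists P? xs))
... | no  _ = ∈-++⁺ʳ _ (filter∈sublists P? xs)

∈-subsets : ∀ {n} (p : Subset n) → p ∈ₗ subsets n
∈-subsets Vec.[]              = here ≡.refl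
∈-subsets (inside  Vec.∷ p) = ∈-++⁺ˡ (∈-map⁺ _ (∈-subsets p))
∈-subsets (outside Vec.∷ p) = ∈-++⁺ʳ _ (∈-map⁺ _ (∈-subsets p))

subsets-unique : ∀ n → Unique (subsets n)
subsets-unique zero    = [] ∷ []
subsets-unique (suc n) =
  Unique.++⁺ (Unique.map⁺ (λ { ≡.refl → ≡.refl }) (subsets-unique n))
             (Unique.map⁺ (λ { ≡.refl → ≡.refl }) (subsets-unique n))
             λ { (x∈ , y∈) → disj (∈-map⁻ _ x∈) (∈-map⁻ _ y∈) }
  where
  disj : ∀ {v : Subset (suc n)} → ∃[ x ] (x ∈ₗ subsets n × v ≡ inside Vec.∷ x) →
         ¬ (∃[ y ] (y ∈ₗ subsets n × v ≡ outside Vec.∷ y))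
  disj (_ , _ , ≡.refl) (_ , _ , ())

-- A repeated nonempty part would meet its copy, whereas copies of the empty set are disjoint.
disjoint⇒unique : {P : List (Subset n)} → All Nonempty P → Disjoint P → Unique P
disjoint⇒unique []                []       = []
disjoint⇒unique ((v , v∈p) ∷ ne) (d ∷ ds) =
  All.map (λ { pq ≡.refl → pq (v , x∈p∩q⁺ (v∈p , v∈p)) }) d ∷ disjoint⇒unique ne ds

-- `partitions≥2` contains a partition only in the order in which `subsets`
-- lists its parts.
listed-partition : ∀ {P : List (Subset n)} → IsPartition P → 2 ℕ.≤ length P →
                   ∃[ Q ] Q ∈ₗ partitions≥2 n × Q ↭ P
listed-partition {n} {P} isP 2≤ = Q , Q∈ , Q↭P
  where
  _∈P? : Decidable (_∈ₗ P)
  p ∈P? = any? (Vec.≡-dec Bool._≟_ p) P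

  Q : List (Subset n)
  Q = filter _∈P? (subsets n)

  Q↭P : Q ↭ P
  -- Neither list has repetitions, so having the same members makes them equal as bags.
  Q↭P = ∼bag⇒↭ (unique∧set⇒bag (Unique.filter⁺ _∈P? (subsets-unique n))
    (disjoint⇒unique (nonempty-parts isP) (disjoint-parts isP))
    (mk⇔ (λ q∈ → proj₂ (∈-filter⁻ _∈P? {xs = subsets n} q∈)) (λ p∈P → ∈-filter⁺ _∈P? (∈-subsets _) p∈P)))

  P↭Q : P ↭ Q
  P↭Q = ↭-sym Q↭P

  isQ : IsPartition Q
  isQ = All-resp-↭ P↭Q (nonempty-parts isP)
      , ↭ₛ.AllPairs-resp-↭ (≡.setoid (Subset n)) (λ {p} {q} → subst Empty (∩-comm p q)) (≡.resp₂ _)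
          (↭⇒↭ₛ P↭Q) (disjoint-parts isP)
      , λ v → Any-resp-↭ P↭Q (covered isP v)

  Q∈ : Q ∈ₗ partitions≥2 n
  Q∈ = ∈-filter⁺ (λ P → isPartition? P ×-dec (2 ℕ.≤? length P)) (filter∈sublists _∈P? (subsets n))
         (isQ , subst (2 ℕ.≤_) (↭-length P↭Q) 2≤)

partsMet-↭ : ∀ (X : Subset n) {P Q} → P ↭ Q → partsMet X P ≡ partsMet X Q
partsMet-↭ X P↭Q = ↭-length (filter-↭ (meets? X) P↭Q)

-- Sorting by an order which is total only up to double negation

module _ {_≲_ : Rel A p} (≲-trans : Transitive _≲_) (total : ∀ x y → ¬ ¬ (x ≲ y ⊎ y ≲ x)) where

  -- The insertion step of insertion sort in continuation-passing style: since the goal is a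
  -- negation, `total` can be used as a comparison.
  ¬¬-insert : ∀ x {ys} → AllPairs _≲_ ys → ¬ ¬ (∃[ zs ] AllPairs _≲_ zs × zs ↭ x ∷ ys)
  ¬¬-insert x {[]}     []       k = k (x ∷ [] , [] ∷ [] , ↭-refl)
  ¬¬-insert x {y ∷ ys} (y≲ ∷ s) k = total x y λ
    { (inj₁ x≲y) → k (x ∷ y ∷ ys , (x≲y ∷ All.map (≲-trans x≲y) y≲) ∷ y≲ ∷ s , ↭-refl)
    ; (inj₂ y≲x) → ¬¬-insert x s λ
        { (zs , zs-sorted , zs↭) →
            k (y ∷ zs , All-resp-↭ (↭-sym zs↭) (y≲x ∷ y≲) ∷ zs-sorted
              , ↭-trans (↭-prep y zs↭) (↭-swap y x ↭-refl)) } }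

  ¬¬-sort : ∀ xs → ¬ ¬ (∃[ ys ] AllPairs _≲_ ys × ys ↭ xs)
  ¬¬-sort []       k = k ([] , [] , ↭-refl)
  ¬¬-sort (x ∷ xs) k = ¬¬-sort xs λ
    { (ys , ys-sorted , ys↭xs) → ¬¬-insert x ys-sorted λ
        { (zs , zs-sorted , zs↭) → k (zs , zs-sorted , ↭-trans zs↭ (↭-prep x ys↭xs)) } }

-- Ordered field arithmetic

module OrderedField {c ℓ₁ ℓ₂} (R : RealNumbers c ℓ₁ ℓ₂) where

  open RealNumbers R
  open Modulus R
  open CommutativeRing commutativeRing using (commutativeSemiring; +-commutativeMonoid; +-monoid; ring)
  open RingProperties ring using (x[y-z]≈xy-xz)
  open IsStrictPartialOrder isStrictPartialOrder
    using (<-respˡ-≈; <-respʳ-≈; asym) renaming (irrefl to <-irrefl)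
  open Solver commutativeSemiring public using (solve; _:=_; _:+_; _:*_)
  open Mult +-monoid using (×-homo-+)
  open FiniteSum +-commutativeMonoid using (sum-cong-≋; ∑-distrib-+; sum-replicate-zero)

  ≤-reflexive : ∀ {x y} → x ≈ y → x ≤ y
  ≤-reflexive x≈y y<x = <-irrefl (sym x≈y) y<x

  ≤-trans : Transitive _≤_
  ≤-trans {x} {y} x≤y y≤z z<x with <-cotrans z<x y
  ... | inj₁ z<y = y≤z z<y
  ... | inj₂ y<x = x≤y y<x

  -- Apartness would give a strict inequality one way or the other, and apartness is tight.
  ≤-antisym : ∀ {x y} → x ≤ y → y ≤ x → x ≈ y
  ≤-antisym x≤y y≤x = proj₁ (tight _ _) λ x#y → case #⇒<⊎> x#y of λ
    { (inj₁ x<y) → y≤x x<y ; (inj₂ y<x) → x≤y y<x }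

  <⇒≤ : ∀ {x y} → x < y → x ≤ y
  <⇒≤ x<y y<x = asym x<y y<x

  ≤-¬¬total : ∀ x y → ¬ ¬ (x ≤ y ⊎ y ≤ x)
  ≤-¬¬total x y k = k (inj₁ λ y<x → k (inj₂ (<⇒≤ y<x)))

  ≤-preorder : Preorder _ _ _
  ≤-preorder = record
    { _≈_        = _≈_
    ; _≲_        = _≤_
    ; isPreorder = record { isEquivalence = isEquivalence ; reflexive = ≤-reflexive ; trans = ≤-trans }
    }

  ≤-refl : ∀ {x} → x ≤ x
  ≤-refl = ≤-reflexive refl

  x+y-y≈x : ∀ x y → (x + y) + - y ≈ x
  x+y-y≈x x y = trans (+-assoc x y (- y)) (trans (+-congˡ (-‿inverseʳ y)) (+-identityʳ x))

  x-y+y≈x : ∀ x y → (x + - y) + y ≈ x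
  x-y+y≈x x y = trans (+-assoc x (- y) y) (trans (+-congˡ (-‿inverseˡ y)) (+-identityʳ x))

  +-cancelʳ-≤ : ∀ z {x y} → x + z ≤ y + z → x ≤ y
  +-cancelʳ-≤ z x+z≤y+z y<x = x+z≤y+z (+-monoˡ-< z y<x)

  +-monoˡ-≤ : ∀ z {x y} → x ≤ y → x + z ≤ y + z
  +-monoˡ-≤ z {x} {y} x≤y y+z<x+z =
    x≤y (<-respˡ-≈ (x+y-y≈x y z) (<-respʳ-≈ (x+y-y≈x x z) (+-monoˡ-< (- z) y+z<x+z)))

  +-mono-≤ : ∀ {w x y z} → w ≤ x → y ≤ z → w + y ≤ x + z
  +-mono-≤ {w} {x} {y} {z} w≤x y≤z = begin
    w + y ≲⟨ +-monoˡ-≤ y w≤x ⟩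
    x + y ≈⟨ +-comm x y ⟩
    y + x ≲⟨ +-monoˡ-≤ x y≤z ⟩
    z + x ≈⟨ +-comm z x ⟩
    x + z ∎
    where open PreorderReasoning ≤-preorder

  x≤y⇒0≤y-x : ∀ {x y} → x ≤ y → 0# ≤ y + - x
  x≤y⇒0≤y-x {x} x≤y = ≤-trans (≤-reflexive (sym (-‿inverseʳ x))) (+-monoˡ-≤ (- x) x≤y)

  *-monoʳ-< : ∀ {a x y} → 0# < a → x < y → a * x < a * y
  *-monoʳ-< {a} {x} {y} 0<a x<y =
    <-respˡ-≈ (+-identityˡ (a * x)) (<-respʳ-≈ (trans (+-congʳ (x[y-z]≈xy-xz a y x)) (x-y+y≈x (a * y) (a * x)))
      (+-monoˡ-< (a * x) (*-pos 0<a
        (<-respˡ-≈ (-‿inverseʳ x) (+-monoˡ-< (- x) x<y)))))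

  -- Whether `a` is zero or positive cannot be decided. Instead, a failure of the inequality forces
  -- `a ≈ 0#`, where both products vanish.
  *-monoʳ-≤ : ∀ {a x y} → 0# ≤ a → x ≤ y → a * x ≤ a * y
  *-monoʳ-≤ {a} {x} {y} 0≤a x≤y ay<ax =
    <-irrefl (trans (*-congʳ a≈0) (trans (zeroˡ y) (sym (trans (*-congʳ a≈0) (zeroˡ x))))) ay<ax
    where
    -- If 0 < a, then x < y is impossible as well, so that x ≈ y.
    a≈0 : a ≈ 0#
    a≈0 = ≤-antisym
      (λ 0<a → <-irrefl (*-congˡ (sym (≤-antisym x≤y λ x<y → asym (*-monoʳ-< 0<a x<y) ay<ax))) ay<ax)
      0≤a

  *-nonneg : ∀ {x y} → 0# ≤ x → 0# ≤ y → 0# ≤ x * y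
  *-nonneg {x} 0≤x 0≤y = ≤-trans (≤-reflexive (sym (zeroʳ x))) (*-monoʳ-≤ 0≤x 0≤y)

  inverse-nonneg : ∀ {x y} → 0# < x → x * y ≈ 1# → 0# ≤ y
  inverse-nonneg {x} 0<x xy≈1 y<0 =
    asym 0<1 (<-respˡ-≈ xy≈1 (<-respʳ-≈ (zeroʳ x) (*-monoʳ-< 0<x y<0)))

  fromℕ-nonneg : ∀ k → 0# ≤ fromℕ k
  fromℕ-nonneg zero    = ≤-refl
  fromℕ-nonneg (suc k) = <⇒≤ (fromℕ-pos k)

  fromℕ-mono-≤ : ∀ {i j} → i ℕ.≤ j → fromℕ i ≤ fromℕ j
  fromℕ-mono-≤ {j = j} z≤n = fromℕ-nonneg j
  fromℕ-mono-≤ (s≤s i≤j) = +-mono-≤ ≤-refl (fromℕ-mono-≤ i≤j)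

  fromℕ-+ : ∀ i j → fromℕ (i ℕ.+ j) ≈ fromℕ i + fromℕ j
  fromℕ-+ = ×-homo-+ 1#

  -- This is `(s - r) * x ≤ (s - r) * y` with the negative terms moved across.
  rearrangement : ∀ {r s x y} → r ≤ s → x ≤ y → s * x + r * y ≤ s * y + r * x
  rearrangement {r} {s} {x} {y} r≤s x≤y = begin
    s * x + r * y             ≈⟨ split x y ⟩
    d * x + (r * x + r * y)   ≲⟨ +-monoˡ-≤ _ (*-monoʳ-≤ (x≤y⇒0≤y-x r≤s) x≤y) ⟩
    d * y + (r * x + r * y)   ≈⟨ +-congˡ (+-comm _ _) ⟩
    d * y + (r * y + r * x)   ≈⟨ split y x ⟨
    s * y + r * x             ∎
    where
    open PreorderReasoning ≤-preorder
    d : Carrier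
    d = s + - r
    split : ∀ x y → s * x + r * y ≈ d * x + (r * x + r * y)
    split x y = trans (+-congʳ (*-congʳ (sym (x-y+y≈x s r))))
      (solve 4 (λ d r x y → (d :+ r) :* x :+ r :* y := d :* x :+ (r :* x :+ r :* y)) refl d r x y)

  -- Finite sums and minima

  sum-mono-≤ : ∀ {m} {f g : Vector Carrier m} → (∀ i → f i ≤ g i) → sum f ≤ sum g
  sum-mono-≤ {zero}  f≤g = ≤-refl
  sum-mono-≤ {suc m} f≤g = +-mono-≤ (f≤g Fin.zero) (sum-mono-≤ (f≤g ∘ Fin.suc))

  sum-0 : ∀ {m} {f : Vector Carrier m} → (∀ i → f i ≈ 0#) → sum f ≈ 0#
  sum-0 {m} f≈0 = trans (sum-cong-≋ f≈0) (sum-replicate-zero m)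

  ∑ : (A → Carrier) → List A → Carrier
  ∑ f []       = 0#
  ∑ f (x ∷ xs) = f x + ∑ f xs

  ∑-++ : ∀ (f : A → Carrier) xs ys → ∑ f (xs ++ ys) ≈ ∑ f xs + ∑ f ys
  ∑-++ f []       ys = sym (+-identityˡ _)
  ∑-++ f (x ∷ xs) ys = trans (+-congˡ (∑-++ f xs ys)) (sym (+-assoc _ _ _))

  ∑-replicate : ∀ (f : A → Carrier) k x → ∑ f (replicate k x) ≈ fromℕ k * f x
  ∑-replicate f zero    x = sym (zeroˡ _)
  ∑-replicate f (suc k) x = trans (+-cong (sym (*-identityˡ _)) (∑-replicate f k x)) (sym (distribʳ _ _ _))

  ∑-↭ : ∀ (f : A → Carrier) {xs ys} → xs ↭ ys → ∑ f xs ≈ ∑ f ys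
  ∑-↭ f _↭_.refl          = refl
  ∑-↭ f (_↭_.prep x r)    = +-congˡ (∑-↭ f r)
  ∑-↭ f (_↭_.swap x y r)  = trans (sym (+-assoc _ _ _)) (trans (+-cong (+-comm _ _) (∑-↭ f r)) (+-assoc _ _ _))
  ∑-↭ f (_↭_.trans r s)   = trans (∑-↭ f r) (∑-↭ f s)

  ∑-tabulate : ∀ {m} (f : A → Carrier) (g : Fin m → A) → ∑ f (tabulate g) ≈ sum (f ∘ g)
  ∑-tabulate {m = zero}  f g = refl
  ∑-tabulate {m = suc m} f g = +-congˡ (∑-tabulate f (g ∘ Fin.suc))

  ∑-indicator : {P : Pred A p} (P? : Decidable P) (u : Carrier) → ∀ xs →
                ∑ (λ x → if ⌊ P? x ⌋ then u else 0#) xs ≈ fromℕ (count P? xs) * u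
  ∑-indicator P? u []       = sym (zeroˡ u)
  ∑-indicator P? u (x ∷ xs) with P? x
  ... | yes _ = trans (+-cong (sym (*-identityˡ u)) (∑-indicator P? u xs)) (sym (distribʳ u _ _))
  ... | no  _ = trans (+-identityˡ _) (∑-indicator P? u xs)

  sum-single : ∀ {m} (f : Vector Carrier m) i →
               sum (λ e → if does (e ≟ᶠ i) then f e else 0#) ≈ f i
  sum-single {suc m} f Fin.zero = trans (+-congˡ (sum-replicate-zero m)) (+-identityʳ _)
  sum-single f (Fin.suc i) = trans (+-identityˡ _) (sum-single (f ∘ Fin.suc) i)

  -- Each member `i` adds a unit vector to the multiplicities and hence `f i` to the product. This
  -- turns the products in `Adm` into sums along a list.
  multiplicity-∑ : ∀ {m} (f : Vector Carrier m) A → (λ e → fromℕ (multiplicity A e)) ∙ f ≈ ∑ f A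
  multiplicity-∑ f []      = sum-0 λ e → zeroˡ (f e)
  multiplicity-∑ f (i ∷ A) =
    trans (sum-cong-≋ step) (trans (∑-distrib-+ (λ e → if does (e ≟ᶠ i) then f e else 0#) _)
      (+-cong (sum-single f i) (multiplicity-∑ f A)))
    where
    step : ∀ e → fromℕ (multiplicity (i ∷ A) e) * f e ≈
                 (if does (e ≟ᶠ i) then f e else 0#) + fromℕ (multiplicity A e) * f e
    step e with does (e ≟ᶠ i)
    ... | true  = trans (distribʳ (f e) _ _) (+-congʳ (*-identityˡ (f e)))
    ... | false = sym (+-identityˡ _)

  minimum-≤ : ∀ {x xs} → x ∈ₗ xs → minimum xs ≤ x
  minimum-≤ {xs = _ ∷ []}    (here ≡.refl) = ≤-refl
  minimum-≤ {xs = y ∷ _ ∷ _} (here ≡.refl) = proj₁ (⊓-infimum y _)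
  minimum-≤ {xs = y ∷ _ ∷ _} (there x∈)    = ≤-trans (proj₁ (proj₂ (⊓-infimum y _))) (minimum-≤ x∈)

  -- The membership excludes the empty list, where `minimum` is a placeholder.
  ≤-minimum : ∀ {t y xs} → y ∈ₗ xs → All (t ≤_) xs → t ≤ minimum xs
  ≤-minimum {xs = _ ∷ []}    _ (t≤x ∷ []) = t≤x
  ≤-minimum {t} {xs = x ∷ _ ∷ _} _ (t≤x ∷ t≤xs) =
    proj₂ (proj₂ (⊓-infimum x _)) t t≤x (≤-minimum (here ≡.refl) t≤xs)

  sum-distribʳ : ∀ {m} (f : Vector Carrier m) x → sum f * x ≈ sum λ i → f i * x
  sum-distribʳ {zero}  f x = zeroˡ x
  sum-distribʳ {suc m} f x = trans (distribʳ x _ _) (+-congˡ (sum-distribʳ (f ∘ Fin.suc) x))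

  if-nonneg : ∀ b {x} → 0# ≤ x → 0# ≤ (if b then x else 0#)
  if-nonneg true  0≤x = 0≤x
  if-nonneg false _   = ≤-refl

-- Strength and modulus

module Duality {c ℓ₁ ℓ₂} (R : RealNumbers c ℓ₁ ℓ₂) (H : Hypergraph)
               (σ : Vector (RealNumbers.Carrier R) (Hypergraph.∣E∣ H))
               (0<σ : ∀ e → RealNumbers._<_ R (RealNumbers.0# R) (σ e)) where

  open RealNumbers R
  open Modulus R
  open OrderedField R
  open Hypergraph H
  open PreorderReasoning ≤-preorder
  open FiniteSum (CommutativeRing.+-commutativeMonoid commutativeRing) using (sum-cong-≋)

  S : Carrier
  S = strength H σ

  ratio : List (Subset ∣V∣) → Carrier
  ratio P = weight σ (δ H P) /ℕ (length P ∸ 1)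

  crosses? : ∀ P → Decidable (Crosses H P)
  crosses? P e = 2 ℕ.≤? partsMet (edge e) P

  weight-δ : ∀ P → weight σ (δ H P) ≈ sum λ e → if ⌊ crosses? P e ⌋ then σ e else 0#
  weight-δ P = sum-cong-≋ λ e → reflexive (cong (λ b → if b then σ e else 0#) (Vec.lookup∘tabulate _ e))

  weight-nonneg : ∀ F → 0# ≤ weight σ F
  weight-nonneg F = ≤-trans (≤-reflexive (sym (sum-0 {m = ∣E∣} {f = λ _ → 0#} λ _ → refl)))
    (sum-mono-≤ {f = λ _ → 0#} λ e → if-nonneg (Vec.lookup F e) (<⇒≤ (0<σ e)))

  ratio-nonneg : ∀ P → 0# ≤ ratio P
  ratio-nonneg P with length P ∸ 1
  ... | zero  = ≤-refl
  ... | suc k = *-nonneg (weight-nonneg (δ H P))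
    (inverse-nonneg (fromℕ-pos k) (proj₂ (inverse (fromℕ-pos k))))

  ratio-cong : ∀ {P Q} → P ↭ Q → ratio P ≡ ratio Q
  ratio-cong P↭Q = cong₂ (λ F k → weight σ F /ℕ (k ∸ 1))
    (Vec.tabulate-cong λ e → cong (λ k → ⌊ 2 ℕ.≤? k ⌋) (partsMet-↭ (edge e) P↭Q)) (↭-length P↭Q)

  -- The minimum runs over partitions in one fixed order of parts only, but the ratio does not
  -- depend on that order.
  S≤ratio : ∀ {P} → IsPartition P → 2 ℕ.≤ length P → S ≤ ratio P
  S≤ratio isP 2≤ with Q , Q∈ , Q↭P ← listed-partition isP 2≤ =
    ≤-trans (minimum-≤ (∈-map⁺ ratio Q∈)) (≤-reflexive (reflexive (ratio-cong Q↭P)))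

  -- The partition into singletons shows that the list being minimised is nonempty.
  ≤S : 2 ℕ.≤ ∣V∣ → ∀ {t} → (∀ {P} → IsPartition P → 2 ℕ.≤ length P → t ≤ ratio P) → t ≤ S
  ≤S 2≤∣V∣ t≤ratio
    with _ , Q∈ , _ ← listed-partition (singletons-isPartition ∣V∣)
                                       (subst (2 ℕ.≤_) (≡.sym (length-singletons ∣V∣)) 2≤∣V∣) =
    ≤-minimum (∈-map⁺ ratio Q∈) (All.map⁺ (All.tabulate λ P∈ →
      let _ , isP , 2≤ = ∈-filter⁻ (λ P → isPartition? P ×-dec (2 ℕ.≤? length P)) {xs = sublists (subsets ∣V∣)} P∈
      in t≤ratio isP 2≤))

  S-nonneg : 2 ℕ.≤ ∣V∣ → 0# ≤ S
  S-nonneg 2≤∣V∣ = ≤S 2≤∣V∣ λ {P} _ _ → ratio-nonneg P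

  -- The bound on the ratio with its denominator cleared. In this form it includes a single part,
  -- where the left side is zero, so it applies at every stage of the greedy algorithm.
  S*[∣P∣-1]≤weight : ∀ {P} → IsPartition P → S * fromℕ (length P ∸ 1) ≤ weight σ (δ H P)
  S*[∣P∣-1]≤weight {[]}        _   = ≤-trans (≤-reflexive (zeroʳ S)) (weight-nonneg (δ H []))
  S*[∣P∣-1]≤weight {p ∷ []}    _   = ≤-trans (≤-reflexive (zeroʳ S)) (weight-nonneg (δ H (p ∷ [])))
  S*[∣P∣-1]≤weight {P@(_ ∷ Q@(_ ∷ Q′))} isP = begin
    S * N            ≈⟨ *-comm S N ⟩
    N * S            ≲⟨ *-monoʳ-≤ (fromℕ-nonneg (length Q)) (S≤ratio isP (s≤s (s≤s z≤n))) ⟩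
    N * (W * N⁻¹)    ≈⟨ solve 3 (λ N W M → N :* (W :* M) := W :* (N :* M)) refl N W N⁻¹ ⟩
    W * (N * N⁻¹)    ≈⟨ *-congˡ (proj₂ (inverse (fromℕ-pos (length Q′)))) ⟩
    W * 1#           ≈⟨ *-identityʳ W ⟩
    W                ∎
    where
    N W N⁻¹ : Carrier
    N   = fromℕ (length Q)
    W   = weight σ (δ H P)
    N⁻¹ = proj₁ (inverse (fromℕ-pos (length Q′)))

  -- Upper bound: densities supported on a cut

  admissible-cut : ∀ {P} → IsPartition P → 2 ℕ.≤ length P → ∃[ ρ ] Adm (Ω H) ρ × ratio P ≈ σ ∙ ρ
  admissible-cut {P} isP 2≤∣P∣ with length P in eq | 2≤∣P∣
  ... | suc zero    | s≤s ()
  -- The divisor `length P ∸ 1` is now `suc k`, so `ratio P` reduces to multiplication by `u`.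
  ... | suc (suc k) | _ = ρ , (ρ-nonneg , 1≤γ∙ρ) , cost
    where
    u : Carrier
    u = proj₁ (inverse (fromℕ-pos k))

    u-inverse : fromℕ (suc k) * u ≈ 1#
    u-inverse = proj₂ (inverse (fromℕ-pos k))

    0≤u : 0# ≤ u
    0≤u = inverse-nonneg (fromℕ-pos k) u-inverse

    ρ : Vector Carrier ∣E∣
    ρ e = if ⌊ crosses? P e ⌋ then u else 0#

    ρ-nonneg : ∀ e → 0# ≤ ρ e
    ρ-nonneg e = if-nonneg ⌊ crosses? P e ⌋ 0≤u

    1≤γ∙ρ : ∀ γ → Ω H γ → 1# ≤ γ ∙ ρ
    1≤γ∙ρ γ (T , T-spans , γ≈) = begin
      1#                                    ≈⟨ u-inverse ⟨
      fromℕ (suc k) * u                     ≈⟨ *-comm _ u ⟩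
      u * fromℕ (suc k)                     ≲⟨ *-monoʳ-≤ 0≤u (fromℕ-mono-≤ (ℕ.s≤s⁻¹ enough)) ⟩
      u * fromℕ (count (crosses? P) T)      ≈⟨ *-comm u _ ⟩
      fromℕ (count (crosses? P) T) * u      ≈⟨ ∑-indicator (crosses? P) u T ⟨
      ∑ ρ T                                 ≈⟨ multiplicity-∑ ρ T ⟨
      (λ e → fromℕ (multiplicity T e)) ∙ ρ  ≈⟨ sum-cong-≋ (λ e → *-congʳ (γ≈ e)) ⟨
      γ ∙ ρ                                 ∎
      where
      enough : suc (suc k) ℕ.≤ suc (count (crosses? P) T)
      enough = subst (ℕ._≤ suc (count (crosses? P) T)) eq (crossing-members H T P T-spans isP)

    cost : weight σ (δ H P) * u ≈ σ ∙ ρ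
    cost = trans (*-congʳ (weight-δ P))
      (trans (sum-distribʳ (λ e → if ⌊ crosses? P e ⌋ then σ e else 0#) u)
             (sum-cong-≋ λ e → term ⌊ crosses? P e ⌋ (σ e)))
      where
      term : ∀ b x → (if b then x else 0#) * u ≈ x * (if b then u else 0#)
      term true  x = refl
      term false x = trans (zeroˡ u) (sym (zeroʳ x))

  -- Every crossing edge has multiplicity at least 1 in `es`, and further entries only add positive
  -- weight.
  weight-δ≤∑ : ∀ {P es} → (∀ e → Crosses H P e → e ∈ₗ es) → weight σ (δ H P) ≤ ∑ σ es
  weight-δ≤∑ {P} {es} crossing = begin
    weight σ (δ H P)                                    ≈⟨ weight-δ P ⟩
    (sum λ e → if ⌊ crosses? P e ⌋ then σ e else 0#)    ≲⟨ sum-mono-≤ term ⟩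
    (λ e → fromℕ (multiplicity es e)) ∙ σ               ≈⟨ multiplicity-∑ σ es ⟩
    ∑ σ es                                              ∎
    where
    term : ∀ e → (if ⌊ crosses? P e ⌋ then σ e else 0#) ≤ fromℕ (multiplicity es e) * σ e
    term e with crosses? P e
    ... | no  _  = *-nonneg (fromℕ-nonneg (multiplicity es e)) (<⇒≤ (0<σ e))
    ... | yes c = begin
      σ e                              ≈⟨ *-identityʳ (σ e) ⟨
      σ e * 1#                         ≈⟨ *-congˡ (+-identityʳ 1#) ⟨
      σ e * fromℕ 1                    ≲⟨ *-monoʳ-≤ (<⇒≤ (0<σ e)) (fromℕ-mono-≤ (filter-some (e ≟ᶠ_) (crossing e c))) ⟩
      σ e * fromℕ (multiplicity es e)  ≈⟨ *-comm (σ e) _ ⟩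
      fromℕ (multiplicity es e) * σ e  ∎

  -- Lower bound: the cost of an admissible density

  module _ (conn : Connected H) (ρ : Vector Carrier ∣E∣) where

    cost : Vector Carrier ∣E∣
    cost e = σ e * ρ e

    -- Summation by parts along the greedy algorithm, with r the value of ρ at
    -- the preceding edge:  S (ρ(T) - r (|P| - 1)) ≤ Σ_{e ∈ es} σ(e) (ρ(e) - r),
    -- with the negative terms moved across.
    summation-by-parts : ∀ es {P r} → IsPartition P → (∀ e → Crosses H P e → e ∈ₗ es) →
      AllPairs (λ e f → ρ e ≤ ρ f) es → All (λ e → r ≤ ρ e) es →
      S * ∑ ρ (greedy H P es) + r * ∑ σ es ≤ ∑ cost es + r * (S * fromℕ (length P ∸ 1))
    summation-by-parts [] {P} {r} isP crossing _ _
      -- With no edge left there is one part, so `length P ∸ 1` is zero and both sides vanish.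
      rewrite uncrossed⇒length≡1 H conn isP (λ e c → contradiction (crossing e c) λ ()) = ≤-reflexive
        (trans (+-cong (zeroʳ S) (zeroʳ r)) (+-congˡ (sym (trans (*-congˡ (zeroʳ S)) (zeroʳ r)))))
    summation-by-parts (e ∷ es) {P} {r} isP crossing (e≤es ∷ sorted) (r≤e ∷ _) =
      -- The added terms are those with coefficient `ρ e` in the induction hypothesis, which takes
      -- `ρ e` as its preceding value. Each side then regroups into a side of `ih` plus a side of
      -- `rearrangement`.
      +-cancelʳ-≤ (ρ e * s + ρ e * (S * fromℕ p′)) (begin
        (S * ∑ ρ (greedy H P (e ∷ es)) + r * (σ e + s)) + (ρ e * s + ρ e * (S * fromℕ p′))
          ≈⟨ +-congʳ (+-congʳ (*-congˡ (trans (∑-++ ρ (replicate k e) _) (+-congʳ (∑-replicate ρ k e))))) ⟩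
        (S * (fromℕ k * ρ e + T) + r * (σ e + s)) + (ρ e * s + ρ e * (S * fromℕ p′))
          ≈⟨ solve 8 (λ S q x T r y s p′ →
               (S :* (q :* x :+ T) :+ r :* (y :+ s)) :+ (x :* s :+ x :* (S :* p′)) :=
               (S :* T :+ x :* s) :+ (x :* (S :* (p′ :+ q)) :+ r :* (y :+ s)))
               refl S (fromℕ k) (ρ e) T r (σ e) s (fromℕ p′) ⟩
        (S * T + ρ e * s) + (ρ e * (S * (fromℕ p′ + fromℕ k)) + r * (σ e + s))
          ≲⟨ +-mono-≤ ih (rearrangement r≤e S[∣P∣-1]≤) ⟩
        (∑ cost es + ρ e * (S * fromℕ p′)) + (ρ e * (σ e + s) + r * (S * (fromℕ p′ + fromℕ k)))
          ≈⟨ solve 8 (λ S q x C r y s p′ →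
               (C :+ x :* (S :* p′)) :+ (x :* (y :+ s) :+ r :* (S :* (p′ :+ q))) :=
               ((y :* x :+ C) :+ r :* (S :* (p′ :+ q))) :+ (x :* s :+ x :* (S :* p′)))
               refl S (fromℕ k) (ρ e) (∑ cost es) r (σ e) s (fromℕ p′) ⟩
        ((cost e + ∑ cost es) + r * (S * (fromℕ p′ + fromℕ k))) + (ρ e * s + ρ e * (S * fromℕ p′))
          ≈⟨ +-congʳ (+-congˡ (*-congˡ (*-congˡ ∣P∣-1))) ⟨
        (∑ cost (e ∷ es) + r * (S * fromℕ (length P ∸ 1))) + (ρ e * s + ρ e * (S * fromℕ p′)) ∎)
      where
      k p′ : ℕ
      k  = partsMet (edge e) P ∸ 1
      p′ = length (merge (edge e) P) ∸ 1

      s T : Carrier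
      s = ∑ σ es
      T = ∑ ρ (greedy H (merge (edge e) P) es)

      ∣P∣-1 : fromℕ (length P ∸ 1) ≈ fromℕ p′ + fromℕ k
      ∣P∣-1 = trans (reflexive (cong fromℕ lengths)) (fromℕ-+ p′ k)
        where
        lengths : length P ∸ 1 ≡ p′ ℕ.+ k
        lengths with partsMet (edge e) P | partsMet-nonempty isP (edge-nonempty H e) | length-merge (edge e) P
        -- The merged list has length `suc p′` by definition; the two successors removed are this
        -- one and that of `suc j`.
        ... | suc j | _ | eq = cong (_∸ 2) (≡.trans (≡.sym eq) (cong suc (ℕ.+-suc p′ j)))

      S[∣P∣-1]≤ : S * (fromℕ p′ + fromℕ k) ≤ σ e + s
      S[∣P∣-1]≤ = begin
        S * (fromℕ p′ + fromℕ k)  ≈⟨ *-congˡ ∣P∣-1 ⟨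
        S * fromℕ (length P ∸ 1)  ≲⟨ S*[∣P∣-1]≤weight isP ⟩
        weight σ (δ H P)          ≲⟨ weight-δ≤∑ {P} {e ∷ es} crossing ⟩
        σ e + s                   ∎

      ih : S * T + ρ e * s ≤ ∑ cost es + ρ e * (S * fromℕ p′)
      ih = summation-by-parts es (merge-isPartition (edge-nonempty H e) isP)
             (merge-crosses H {P} crossing) sorted e≤es

    S≤σ∙ρ : 2 ℕ.≤ ∣V∣ → Adm (Ω H) ρ → S ≤ σ ∙ ρ
    S≤σ∙ρ 2≤∣V∣ (0≤ρ , adm) σ∙ρ<S =
      ¬¬-sort ≤-trans (λ e f → ≤-¬¬total (ρ e) (ρ f)) (allFin ∣E∣)
        λ { (es , sorted , es↭) → bound es sorted es↭ σ∙ρ<S }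
      where
      bound : ∀ es → AllPairs (λ e f → ρ e ≤ ρ f) es → es ↭ allFin ∣E∣ → S ≤ σ ∙ ρ
      bound es sorted es↭ = begin
        S                      ≈⟨ *-identityʳ S ⟨
        S * 1#                 ≲⟨ *-monoʳ-≤ (S-nonneg 2≤∣V∣) (adm _ (T , T-spans , λ _ → refl)) ⟩
        S * ((λ e → fromℕ (multiplicity T e)) ∙ ρ) ≈⟨ *-congˡ (multiplicity-∑ ρ T) ⟩
        -- The summation starts with preceding value zero, a lower bound of `ρ`, so both terms in
        -- `r` vanish.
        S * ∑ ρ T              ≈⟨ trans (+-congˡ (zeroˡ _)) (+-identityʳ _) ⟨
        S * ∑ ρ T + 0# * ∑ σ es
          ≲⟨ summation-by-parts es (singletons-isPartition ∣V∣) (λ e _ → all-es e) sorted (All.universal 0≤ρ es) ⟩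
        ∑ cost es + 0# * (S * fromℕ (length (singletons ∣V∣) ∸ 1))
                               ≈⟨ trans (+-congˡ (zeroˡ _)) (+-identityʳ _) ⟩
        ∑ cost es              ≈⟨ ∑-↭ cost es↭ ⟩
        ∑ cost (allFin ∣E∣)    ≈⟨ ∑-tabulate cost id ⟩
        σ ∙ ρ                  ∎
        where
        all-es : ∀ e → e ∈ₗ es
        all-es e = ∈-resp-↭ (↭-sym es↭) (∈-allFin e)

        T : List (Fin ∣E∣)
        T = greedy H (singletons ∣V∣) es

        T-spans : SpansHypertree H T
        T-spans = greedy-spans H conn 2≤∣V∣ es all-es

mainTheorem6 : ∀ {c ℓ₁ ℓ₂} (R : RealNumbers c ℓ₁ ℓ₂) →
    let open RealNumbers R
        open Modulus R in
    (H : Hypergraph) → Connected H → 2 ℕ.≤ Hypergraph.∣V∣ H →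
    (σ : Vector Carrier (Hypergraph.∣E∣ H)) → (∀ e → 0# < σ e) →
    Mod₁[ σ , Ω H ]≈ strength H σ
mainTheorem6 R H conn 2≤∣V∣ σ 0<σ =
    (λ { x (ρ , adm , x≈) → ≤-trans (S≤σ∙ρ conn ρ 2≤∣V∣ adm) (≤-reflexive (sym x≈)) })
  -- Every ratio is itself the cost of an admissible density, so a lower bound of the costs is one
  -- of the ratios.
  , (λ t t≤ → ≤S 2≤∣V∣ λ isP 2≤∣P∣ → t≤ _ (admissible-cut isP 2≤∣P∣))
  where
  open RealNumbers R using (sym)
  open OrderedField R using (≤-trans; ≤-reflexive)
  open Duality R H σ 0<σ
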